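{- Let $\pi=\pi_1\pi_2\cdots\pi_n$ be a left-crucial permutation with respect to squares such that either $\pi_1<\pi_2<\pi_3$ or $\pi_1>\pi_2>\pi_3$. Then $n\geq 31$.
   Context: Permutations are written in one-line notation. A factor is a sequence of consecutive entries; two sequences of distinct numbers of equal length are order-isomorphic if their entries are in the same relative order. A square is a factor $XY$ with $X,Y$ consecutive, of equal length at least $2$, and order-isomorphic; its length is $2|X|$. A permutation is square-free if it contains no square. For $\pi=\pi_1\cdots\pi_n$ and $x\in\{1,\dots,n+1\}$, the extension of $\pi$ to the left by $x$ is the permutation $x\pi'_1\cdots\pi'_n$ where $\pi'_j=\pi_j$ if $\pi_j<x$ and $\pi'_j=\pi_j+1$ otherwise. A permutation is left-crucial with respect to squares if it is square-free but every extension of it to the left by every $x\in\{1,\dots,n+1\}$ contains a square. -}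

module Defs where

open import Data.Nat using (ℕ; zero; suc; _+_; _<_; _≤_; _<ᵇ_)
open import Data.Bool using (if_then_else_)
open import Data.List using (List; []; _∷_; length; map; take; drop; upTo; zip)
open import Data.List.Relation.Unary.All using (All)
open import Data.List.Relation.Binary.Permutation.Propositional using (_↭_)
open import Data.Product using (Σ; ∃; _×_; _,_)
open import Data.Empty using (⊥)
open import Data.Unit using (⊤)
open import Relation.Nullary using (¬_)

IsPerm : List ℕ → Set
IsPerm π = π ↭ map suc (upTo (length π))

OrderIso : List ℕ → List ℕ → Set
OrderIso [] [] = ⊤
OrderIso [] (_ ∷ _) = ⊥
OrderIso (_ ∷ _) [] = ⊥
OrderIso (x ∷ xs) (y ∷ ys) =
  All (λ p → ((x < Data.Product.proj₁ p → y < Data.Product.proj₂ p)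
            × (y < Data.Product.proj₂ p → x < Data.Product.proj₁ p)))
      (zip xs ys)
  × OrderIso xs ys

factor : ℕ → ℕ → List ℕ → List ℕ
factor i k π = take k (drop i π)

ContainsSquare : List ℕ → Set
ContainsSquare π =
  Σ ℕ λ i → Σ ℕ λ k → 2 ≤ k × i + (k + k) ≤ length π
    × OrderIso (factor i k π) (factor (i + k) k π)

SquareFree : List ℕ → Set
SquareFree π = ¬ ContainsSquare π

extendLeft : ℕ → List ℕ → List ℕ
extendLeft x π = x ∷ map (λ p → if p <ᵇ x then p else suc p) π

LeftCrucial : List ℕ → Set
LeftCrucial π =
  SquareFree π ×
  ((x : ℕ) → 1 ≤ x → x ≤ suc (length π) → ContainsSquare (extendLeft x π))

{-# OPTIONS --safe #-}

-- In a square-free permutation the ascent/descent signs at distance two differ, so they run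
-- t, t, ¬t, ¬t, t, t, … . For x on one side of π₁, the extension by x starts with ¬t,
-- and any square in it is a prefix square of half-length k divisible by 4. Such a square
-- forces the comparisons of x with π₁, π₂, π₃ to be those of π_k with π_{k+1}, π_{k+2}, π_{k+3}.
-- If n ≤ 30 then k ∈ {4, 8, 12}; a square with k = 8 makes the comparisons forced by k = 4
-- and k = 12 equal, so at most two outcomes occur. But three choices of x (just above or
-- just below each of π₁, π₂, π₃) compare differently with π₁, π₂, π₃.
module Submission where

open import Defs
open import Data.Nat using (ℕ; _<_; _>_; _≤_)
open import Data.List using (List; _∷_; length)
open import Data.Product using (_×_)
open import Data.Sum using (_⊎_)
open import Relation.Binary.PropositionalEquality using (_≡_)

open import Data.Bool using (Bool; true; false; not; T; if_then_else_)
import Data.Bool.Properties as Bool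
open import Data.Fin using (zero; suc)
open import Data.List using ([]; map; take; drop; zip)
open import Data.List.Membership.Propositional using (_∈_)
open import Data.List.Membership.Propositional.Properties using (∈-map⁻; ∈-upTo⁻)
open import Data.List.Properties using (length-map; drop-map; take-map)
open import Data.List.Relation.Binary.Permutation.Propositional.Properties using (∈-resp-↭)
open import Data.List.Relation.Unary.All using (All; []; _∷_)
open import Data.List.Relation.Unary.Any using (here; there)
open import Data.Nat using (zero; suc; _+_; _*_; _<ᵇ_; _<?_; z≤n; s≤s; s<s⁻¹)
open import Data.Nat.Divisibility using (_∣_; divides; ∣-refl; ∣m∣n⇒∣m+n)
open import Data.Nat.Properties
open import Data.Product using (Σ; _,_; proj₁; proj₂)
open import Data.Sum using (inj₁; inj₂)
open import Data.Vec using (Vec; []; _∷_; lookup)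
import Data.Vec.Properties as Vec
open import Function using (_∘_; mk⇔)
open import Relation.Binary.PropositionalEquality
  using (_≢_; refl; sym; trans; cong; cong₂; subst; subst₂; module ≡-Reasoning)
open import Relation.Nullary using (¬_; Dec; yes; no; contradiction)
open import Relation.Nullary.Decidable using (dec-true; dec-false; does-⇔)

-- Entries of order-isomorphic lists

-- Entries are numbered from 0, and 0 stands for the missing entries beyond the end.
entry : List ℕ → ℕ → ℕ
entry []       _       = 0
entry (x ∷ xs) zero    = x
entry (x ∷ xs) (suc i) = entry xs i

entry-drop : ∀ i xs j → entry (drop i xs) j ≡ entry xs (i + j)
entry-drop zero    xs       j = refl
entry-drop (suc i) []       j = refl
entry-drop (suc i) (x ∷ xs) j = entry-drop i xs j

entry-take : ∀ {k j} xs → j < k → entry (take k xs) j ≡ entry xs j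
entry-take {suc k} {j}     []       j<k = refl
entry-take {suc k} {zero}  (x ∷ xs) j<k = refl
entry-take {suc k} {suc j} (x ∷ xs) j<k = entry-take xs (s<s⁻¹ j<k)

entry-factor : ∀ i {k j} xs → j < k → entry (factor i k xs) j ≡ entry xs (i + j)
entry-factor i {j = j} xs j<k = trans (entry-take (drop i xs) j<k) (entry-drop i xs j)

SameOrder : ℕ → ℕ → ℕ × ℕ → Set
SameOrder x y p = (x < proj₁ p → y < proj₂ p) × (y < proj₂ p → x < proj₁ p)

-- No bound on the index is needed: order-isomorphic lists have equal lengths, and
-- nothing is below the default entry 0.
head-compare : ∀ {x y} xs ys → All (SameOrder x y) (zip xs ys) → OrderIso xs ys →
               ∀ j → (x <ᵇ entry xs j) ≡ (y <ᵇ entry ys j)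
head-compare []       []       _              _       j       = refl
head-compare {x} {y} (x′ ∷ xs) (y′ ∷ ys) ((to , from) ∷ _) _ zero =
  does-⇔ (mk⇔ to from) (x <? x′) (y <? y′)
head-compare (_ ∷ xs) (_ ∷ ys) (_ ∷ same) (_ , iso) (suc j) = head-compare xs ys same iso j

orderIso-compare : ∀ xs ys → OrderIso xs ys → ∀ {i j} → i < j →
                   (entry xs i <ᵇ entry xs j) ≡ (entry ys i <ᵇ entry ys j)
orderIso-compare []       []       _            _             = refl
orderIso-compare (x ∷ xs) (y ∷ ys) (same , iso) {zero}  {suc j} _   = head-compare xs ys same iso j
orderIso-compare (x ∷ xs) (y ∷ ys) (_ , iso)    {suc i} {suc j} i<j =
  orderIso-compare xs ys iso (s<s⁻¹ i<j)

<ᵇ-≡⇒→ : ∀ {w x y z} → (w <ᵇ x) ≡ (y <ᵇ z) → w < x → y < z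
<ᵇ-≡⇒→ {y = y} {z} eq w<x = <ᵇ⇒< y z (subst T eq (<⇒<ᵇ w<x))

-- Ascent signs of square-free lists

ascent : List ℕ → ℕ → Bool
ascent xs i = entry xs i <ᵇ entry xs (suc i)

squareFree-tail : ∀ {x xs} → SquareFree (x ∷ xs) → SquareFree xs
squareFree-tail free (i , k , 2≤k , fits , iso) = free (suc i , k , 2≤k , s≤s fits , iso)

-- Equal signs at distance two would make two adjacent pairs order-isomorphic, a square of
-- half-length 2.
ascent-flips : ∀ xs i → SquareFree xs → 3 + i < length xs → ascent xs (2 + i) ≡ not (ascent xs i)
ascent-flips (w ∷ x ∷ y ∷ z ∷ xs) zero free _ = Bool.¬-not λ eq →
  free (0 , 2 , ≤-refl , s≤s (s≤s (s≤s (s≤s z≤n))) ,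
        ((<ᵇ-≡⇒→ (sym eq) , <ᵇ-≡⇒→ {y} {z} eq) ∷ []) , [] , _)
ascent-flips (_ ∷ [])         zero _ (s≤s ())
ascent-flips (_ ∷ _ ∷ [])     zero _ (s≤s (s≤s ()))
ascent-flips (_ ∷ _ ∷ _ ∷ []) zero _ (s≤s (s≤s (s≤s ())))
ascent-flips (w ∷ xs) (suc i) free bound = ascent-flips xs i (squareFree-tail free) (s<s⁻¹ bound)

zigzag : Bool → ℕ → Bool
zigzag t 0             = t
zigzag t 1             = t
zigzag t (suc (suc i)) = not (zigzag t i)

ascent-zigzag : ∀ {xs t} → SquareFree xs → ascent xs 0 ≡ t → ascent xs 1 ≡ t →
                ∀ i → suc i < length xs → ascent xs i ≡ zigzag t i
ascent-zigzag free eq₀ eq₁ 0 _ = eq₀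
ascent-zigzag free eq₀ eq₁ 1 _ = eq₁
ascent-zigzag {xs} free eq₀ eq₁ (suc (suc i)) bound =
  trans (ascent-flips xs i free bound)
        (cong not (ascent-zigzag free eq₀ eq₁ i (<-trans (n<1+n _) (<-trans (n<1+n _) bound))))

-- In the period `t`, `t`, `not t`, `not t`, the change from `not t` back to `t` occurs only after
-- the last place.
zigzag-period : ∀ t i → zigzag t i ≡ not t → zigzag t (suc i) ≡ t → 4 ∣ suc i
zigzag-period t 0 eq _ = contradiction eq (Bool.not-¬ refl)
zigzag-period t 1 eq _ = contradiction eq (Bool.not-¬ refl)
zigzag-period t 2 _ eq = contradiction (sym eq) (Bool.not-¬ refl)
zigzag-period t 3 _ _  = ∣-refl
zigzag-period t (suc (suc (suc (suc i)))) eq eq′ =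
  ∣m∣n⇒∣m+n ∣-refl (zigzag-period t i (trans (sym (Bool.not-involutive _)) eq)
                                      (trans (sym (Bool.not-involutive _)) eq′))

-- Extension to the left

shift : ℕ → ℕ → ℕ
shift x v = if v <ᵇ x then v else suc v

shift-< : ∀ {x v} → v < x → shift x v ≡ v
shift-< {x} {v} v<x = cong (if_then v else suc v) (dec-true (v <? x) v<x)

shift-≥ : ∀ {x v} → x ≤ v → shift x v ≡ suc v
shift-≥ {x} {v} x≤v = cong (if_then v else suc v) (dec-false (v <? x) (≤⇒≯ x≤v))

shift-compare : ∀ x u v → (shift x u <ᵇ shift x v) ≡ (u <ᵇ v)
shift-compare x u v with <-≤-connex u x | <-≤-connex v x
... | inj₁ u<x | inj₁ v<x rewrite shift-< u<x | shift-< v<x = refl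
... | inj₁ u<x | inj₂ x≤v rewrite shift-< u<x | shift-≥ x≤v =
  trans (dec-true (u <? suc v) (m<n⇒m<1+n u<v)) (sym (dec-true (u <? v) u<v))
  where u<v = <-≤-trans u<x x≤v
... | inj₂ x≤u | inj₁ v<x rewrite shift-≥ x≤u | shift-< v<x =
  trans (dec-false (suc u <? v) (≤⇒≯ (m≤n⇒m≤1+n v≤u))) (sym (dec-false (u <? v) (≤⇒≯ v≤u)))
  where v≤u = <⇒≤ (<-≤-trans v<x x≤u)
... | inj₂ x≤u | inj₂ x≤v rewrite shift-≥ x≤u | shift-≥ x≤v = refl

<ᵇ-shift-< : ∀ {x v} → v < x → (x <ᵇ shift x v) ≡ false
<ᵇ-shift-< {x} {v} v<x rewrite shift-< v<x = dec-false (x <? v) (<⇒≯ v<x)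

<ᵇ-shift-≥ : ∀ {x v} → x ≤ v → (x <ᵇ shift x v) ≡ true
<ᵇ-shift-≥ {x} {v} x≤v rewrite shift-≥ x≤v = dec-true (x <? suc v) (s≤s x≤v)

entry-map : ∀ {f : ℕ → ℕ} → f 0 ≡ 0 → ∀ xs i → entry (map f xs) i ≡ f (entry xs i)
entry-map f0 []       i       = sym f0
entry-map f0 (x ∷ xs) zero    = refl
entry-map f0 (x ∷ xs) (suc i) = entry-map f0 xs i

extendLeft-compare : ∀ {x} π → 1 ≤ x → ∀ i j →
  let ρ = extendLeft x π in
  (entry ρ (suc i) <ᵇ entry ρ (suc j)) ≡ (entry π i <ᵇ entry π j)
extendLeft-compare {x} π 1≤x i j =
  -- By `1 ≤ x`, `shift x` fixes the default entry 0, so indices beyond the end are covered too.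
  trans (cong₂ _<ᵇ_ (entry-map (shift-< 1≤x) π i) (entry-map (shift-< 1≤x) π j))
        (shift-compare x (entry π i) (entry π j))

module _ {f : ℕ → ℕ} (f-compare : ∀ u v → (f u <ᵇ f v) ≡ (u <ᵇ v)) where

  reflects-< : ∀ {u v} → f u < f v → u < v
  reflects-< {u} {v} = <ᵇ-≡⇒→ (f-compare u v)

  preserves-< : ∀ {u v} → u < v → f u < f v
  preserves-< {u} {v} = <ᵇ-≡⇒→ (sym (f-compare u v))

  sameOrder-map⁻ : ∀ {x y} xs ys → All (SameOrder (f x) (f y)) (zip (map f xs) (map f ys)) →
                   All (SameOrder x y) (zip xs ys)
  sameOrder-map⁻ []       _        _    = []
  sameOrder-map⁻ (_ ∷ _)  []       _    = []
  sameOrder-map⁻ (_ ∷ xs) (_ ∷ ys) ((to , from) ∷ same) =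
    (reflects-< ∘ to ∘ preserves-< , reflects-< ∘ from ∘ preserves-<) ∷ sameOrder-map⁻ xs ys same

  orderIso-map⁻ : ∀ xs ys → OrderIso (map f xs) (map f ys) → OrderIso xs ys
  orderIso-map⁻ []       []       _            = _
  orderIso-map⁻ (_ ∷ xs) (_ ∷ ys) (same , iso) = sameOrder-map⁻ xs ys same , orderIso-map⁻ xs ys iso

factor-map : ∀ (f : ℕ → ℕ) i k xs → factor i k (map f xs) ≡ map f (factor i k xs)
factor-map f i k xs = trans (cong (take k) (drop-map i xs)) (take-map k (drop i xs))

-- Squares at the start of an extension

PrefixSquare : ℕ → List ℕ → Set
PrefixSquare k xs =
  2 ≤ k × k + k ≤ length xs × OrderIso (factor 0 k xs) (factor k k xs)

-- A square starting after the new entry lies in the shifted copy of `π`. As `shift x` reflects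
-- order, it pulls back to a square of `π`.
extension-square : ∀ {x π} → SquareFree π → ContainsSquare (extendLeft x π) →
                   Σ ℕ λ k → PrefixSquare k (extendLeft x π)
extension-square _ (zero , square) = square
extension-square {x} {π} free (suc i , k , 2≤k , s≤s fits , iso) = contradiction
  (i , k , 2≤k , subst (i + (k + k) ≤_) (length-map (shift x) π) fits ,
   orderIso-map⁻ (shift-compare x) _ _
     (subst₂ OrderIso (factor-map (shift x) i k π) (factor-map (shift x) (i + k) k π) iso))
  free

square-compare : ∀ {k xs i j} → PrefixSquare k xs → i < j → j < k →
                 (entry xs i <ᵇ entry xs j) ≡ (entry xs (i + k) <ᵇ entry xs (j + k))
square-compare {k} {xs} {i} {j} (_ , _ , iso) i<j j<k = begin
  (entry xs i <ᵇ entry xs j)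
    ≡⟨ cong₂ _<ᵇ_ (entry-factor 0 xs i<k) (entry-factor 0 xs j<k) ⟨
  (entry (factor 0 k xs) i <ᵇ entry (factor 0 k xs) j)
    ≡⟨ orderIso-compare (factor 0 k xs) (factor k k xs) iso i<j ⟩
  (entry (factor k k xs) i <ᵇ entry (factor k k xs) j)
    ≡⟨ cong₂ _<ᵇ_ (second i<k) (second j<k) ⟩
  (entry xs (i + k) <ᵇ entry xs (j + k)) ∎
  where
  open ≡-Reasoning
  i<k = <-trans i<j j<k
  second : ∀ {l} → l < k → entry (factor k k xs) l ≡ entry xs (l + k)
  second {l} l<k = trans (entry-factor k xs l<k) (cong (entry xs) (+-comm k l))

-- At index 0 of an extension this records how the new entry compares with the first three entries
-- of `π`.
gap : List ℕ → ℕ → Vec Bool 3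
gap xs i = compare 1 ∷ compare 2 ∷ compare 3 ∷ []
  where
  compare : ℕ → Bool
  compare j = entry xs i <ᵇ entry xs (j + i)

gap-cong : ∀ {xs ys i j} →
  (∀ l → 1 ≤ l → l ≤ 3 → (entry xs i <ᵇ entry xs (l + i)) ≡ (entry ys j <ᵇ entry ys (l + j))) →
  gap xs i ≡ gap ys j
gap-cong eq = cong₂ _∷_ (eq 1 (s≤s z≤n) (s≤s z≤n))
  (cong₂ _∷_ (eq 2 (s≤s z≤n) (s≤s (s≤s z≤n))) (cong (_∷ []) (eq 3 (s≤s z≤n) ≤-refl)))

-- The bound keeps entry `i` and the next three inside the first half, so the square copies their
-- comparisons `k` places on.
square-gap : ∀ {k xs i} → PrefixSquare k xs → 3 + i < k → gap xs i ≡ gap xs (i + k)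
square-gap {k} {xs} {i} square bound = gap-cong {xs} {xs} λ l 1≤l l≤3 →
  trans (square-compare square (+-monoˡ-≤ i 1≤l) (≤-<-trans (+-monoˡ-≤ i l≤3) bound))
        (cong (λ j → entry xs (i + k) <ᵇ entry xs j) (+-assoc l i k))

-- This offset turns half-lengths 4, 8, 12 into the gaps of `π` at 3, 7, 11.
gap-extendLeft : ∀ {x} π i → 1 ≤ x → gap (extendLeft x π) (suc i) ≡ gap π i
gap-extendLeft {x} π i 1≤x = gap-cong {extendLeft x π} {π} λ l _ _ →
  trans (cong (λ j → entry (extendLeft x π) (suc i) <ᵇ entry (extendLeft x π) j) (+-suc l i))
        (extendLeft-compare π 1≤x i (l + i))

-- The extension begins with signs `not t`, `t`. A half of three or more entries contains both, and
-- the square repeats them at indices `k - 1` and `k` of `π`, where `zigzag-period` applies.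
square-halfLength : ∀ {t x π k} → SquareFree π → ascent π 0 ≡ t → ascent π 1 ≡ t →
  1 ≤ x → ascent (extendLeft x π) 0 ≡ not t → PrefixSquare k (extendLeft x π) → 4 ∣ k
square-halfLength {k = 0} _ _ _ _ _ (() , _)
square-halfLength {k = 1} _ _ _ _ _ (s≤s () , _)
-- A half of two entries has one sign, `not t`. Its copy is the sign of `π` at index 1, which is
-- `t`.
square-halfLength {π = π} {2} free eq₀ eq₁ 1≤x start square = contradiction
  (trans (sym eq₁) (trans (sym (extendLeft-compare π 1≤x 1 2))
    (trans (sym (square-compare square (s≤s z≤n) ≤-refl)) start)))
  (Bool.not-¬ refl)
square-halfLength {t} {x} {π} {suc (suc (suc k))} free eq₀ eq₁ 1≤x start square@(_ , fits , _) =
  zigzag-period t (2 + k)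
    (trans (sym (signs (2 + k) (<⇒≤ bound)))
      (trans (sym (extendLeft-compare π 1≤x (2 + k) (3 + k)))
        (trans (sym (square-compare square (s≤s z≤n) (s≤s (s≤s z≤n)))) start)))
    (trans (sym (signs (3 + k) bound))
      (trans (sym (extendLeft-compare π 1≤x (3 + k) (4 + k)))
        (trans (sym (square-compare square ≤-refl (s≤s (s≤s (s≤s z≤n)))))
          (trans (extendLeft-compare π 1≤x 0 1) eq₀))))
  where
  signs = ascent-zigzag {π} {t} free eq₀ eq₁
  -- The half-length is `3 + k`, at least 3, which leaves room to read the sign of `π` at index
  -- `3 + k`.
  bound : 4 + k < length π
  bound = s<s⁻¹ (≤-trans (+-monoˡ-≤ (3 + k) (s≤s (s≤s (s≤s (z≤n {k})))))
                         (subst (3 + k + (3 + k) ≤_) (cong suc (length-map (shift x) π)) fits))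

-- An extension has at most 31 entries when `π` has at most 30, and half-length 16 would take 32.
-- The value 8 is set apart because it also links the gaps belonging to 4 and 12.
short-multiples : ∀ {k} → 2 ≤ k → k + k ≤ 31 → 4 ∣ k → (k ≡ 4 ⊎ k ≡ 12) ⊎ k ≡ 8
short-multiples () _ (divides 0 refl)
short-multiples _  _ (divides 1 refl) = inj₁ (inj₁ refl)
short-multiples _  _ (divides 2 refl) = inj₂ refl
short-multiples _  _ (divides 3 refl) = inj₁ (inj₂ refl)
short-multiples _ short (divides (suc (suc (suc (suc q)))) refl) =
  contradiction (≤-trans (+-mono-≤ 16≤k 16≤k) short) 1+n≰n
  where
  16≤k : 16 ≤ (4 + q) * 4
  16≤k = m≤m+n 16 (q * 4)

-- The last alternative: a prefix square of half-length 8 carries entries 4-7 of the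
-- extension to entries 12-15, so it identifies the gaps that half-lengths 4 and 12 allow.
extension-gap : ∀ {t x π} → SquareFree π → ascent π 0 ≡ t → ascent π 1 ≡ t → length π < 31 →
  1 ≤ x → ContainsSquare (extendLeft x π) → ascent (extendLeft x π) 0 ≡ not t →
  let g = gap (extendLeft x π) 0 in
  (g ≡ gap π 3 ⊎ g ≡ gap π 11) ⊎ (g ≡ gap π 7 × gap π 3 ≡ gap π 11)
extension-gap {t} {x} {π} free eq₀ eq₁ short 1≤x contains start
  with extension-square free contains
... | k , square@(2≤k , fits , _)
  with short-multiples 2≤k
         (≤-trans fits (subst (_≤ 31) (sym (cong suc (length-map (shift x) π))) short))
         (square-halfLength free eq₀ eq₁ 1≤x start square)
... | inj₁ (inj₁ refl) = inj₁ (inj₁ (trans (square-gap square (m≤m+n 4 0)) (gap-extendLeft π 3 1≤x)))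
... | inj₁ (inj₂ refl) = inj₁ (inj₂ (trans (square-gap square (m≤m+n 4 8)) (gap-extendLeft π 11 1≤x)))
... | inj₂ refl = inj₂
  ( trans (square-gap square (m≤m+n 4 4)) (gap-extendLeft π 7 1≤x)
  , trans (sym (gap-extendLeft π 3 1≤x))
      (trans (square-gap square (m≤m+n 8 0)) (gap-extendLeft π 11 1≤x)) )

-- Three insertions against two possible gaps

pigeonhole : ∀ {A : Set} {u v p q r : A} → p ≢ q → p ≢ r → q ≢ r →
             p ≡ u ⊎ p ≡ v → q ≡ u ⊎ q ≡ v → ¬ (r ≡ u ⊎ r ≡ v)
pigeonhole p≢q p≢r q≢r (inj₁ p) (inj₁ q) _        = p≢q (trans p (sym q))
pigeonhole p≢q p≢r q≢r (inj₂ p) (inj₂ q) _        = p≢q (trans p (sym q))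
pigeonhole p≢q p≢r q≢r (inj₁ p) (inj₂ q) (inj₁ r) = p≢r (trans p (sym r))
pigeonhole p≢q p≢r q≢r (inj₁ p) (inj₂ q) (inj₂ r) = q≢r (trans q (sym r))
pigeonhole p≢q p≢r q≢r (inj₂ p) (inj₁ q) (inj₁ r) = q≢r (trans q (sym r))
pigeonhole p≢q p≢r q≢r (inj₂ p) (inj₁ q) (inj₂ r) = p≢r (trans p (sym r))

-- Keeps the insertion values, which are entries of `π` or their successors, in the range covered by
-- `LeftCrucial`.
perm-bounds : ∀ {π v} → IsPerm π → v ∈ π → 1 ≤ v × v ≤ length π
perm-bounds perm v∈π with ∈-map⁻ suc (∈-resp-↭ perm v∈π)
... | _ , i∈ , refl = s≤s z≤n , ∈-upTo⁻ i∈

module _ (a b c : ℕ) (rest : List ℕ) where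

  private
    π : List ℕ
    π = a ∷ b ∷ c ∷ rest

  head-gap : ℕ → Vec Bool 3
  head-gap x = gap (extendLeft x π) 0

  lookup-head-gap : ∀ x i → lookup (head-gap x) i ≡ (x <ᵇ shift x (lookup (a ∷ b ∷ c ∷ []) i))
  lookup-head-gap x zero             = refl
  lookup-head-gap x (suc zero)       = refl
  lookup-head-gap x (suc (suc zero)) = refl

  -- The entry `v` separates `x` from `y`: coordinate `i` is `true` for `x` and `false` for `y`.
  head-gap-≢ : ∀ {x y} i → (let v = lookup (a ∷ b ∷ c ∷ []) i) → x ≤ v → v < y →
               head-gap x ≢ head-gap y
  head-gap-≢ {x} {y} i x≤v v<y eq = contradiction
    (trans (sym (<ᵇ-shift-≥ x≤v)) (trans (sym (lookup-head-gap x i))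
      (trans (cong (λ g → lookup g i) eq) (trans (lookup-head-gap y i) (<ᵇ-shift-< v<y)))))
    λ ()

  -- The last condition unfolds to the first sign of the extension being `not t`.
  Admissible : Bool → ℕ → Set
  Admissible t x = 1 ≤ x × x ≤ suc (length π) × (x <ᵇ shift x a) ≡ not t

  -- Deciding first whether the gaps at 3 and 11 agree fixes one pair of values for all three
  -- insertions.
  three-gaps⇒long : ∀ {t x y z} → LeftCrucial π → ascent π 0 ≡ t → ascent π 1 ≡ t →
    Admissible t x → Admissible t y → Admissible t z →
    head-gap x ≢ head-gap y → head-gap x ≢ head-gap z → head-gap y ≢ head-gap z →
    31 ≤ length π
  three-gaps⇒long {t} {x} {y} {z} (free , extensions) eq₀ eq₁ X Y Z x≢y x≢z y≢z = ≮⇒≥ λ short →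
    let gaps : ∀ {w} → Admissible t w → Gaps (head-gap w)
        gaps {w} (1≤w , w≤1+n , start) =
          extension-gap {t} {w} {π} free eq₀ eq₁ short 1≤w (extensions w 1≤w w≤1+n) start
    in case (Vec.≡-dec Bool._≟_ (gap π 3) (gap π 11)) (gaps X) (gaps Y) (gaps Z)
    where
    Gaps : Vec Bool 3 → Set
    Gaps g = (g ≡ gap π 3 ⊎ g ≡ gap π 11) ⊎ (g ≡ gap π 7 × gap π 3 ≡ gap π 11)

    case : Dec (gap π 3 ≡ gap π 11) → Gaps (head-gap x) → Gaps (head-gap y) → ¬ Gaps (head-gap z)
    -- Half-lengths 4 and 12 share one value, and 8 adds at most one more.
    case (yes eq) p q r = pigeonhole x≢y x≢z y≢z (merge p) (merge q) (merge r)
      where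
      merge : ∀ {g} → Gaps g → g ≡ gap π 3 ⊎ g ≡ gap π 7
      merge (inj₁ (inj₁ e))  = inj₁ e
      merge (inj₁ (inj₂ e))  = inj₁ (trans e (sym eq))
      merge (inj₂ (e , _))   = inj₂ e
    -- Half-length 8 is impossible here, as it would equate the two gaps.
    case (no neq) p q r = pigeonhole x≢y x≢z y≢z (merge p) (merge q) (merge r)
      where
      merge : ∀ {g} → Gaps g → g ≡ gap π 3 ⊎ g ≡ gap π 11
      merge (inj₁ e)        = e
      merge (inj₂ (_ , eq)) = contradiction eq neq

theorem4 : (π : List ℕ) → IsPerm π → LeftCrucial π →
    (a b c : ℕ) (rest : List ℕ) → π ≡ a ∷ b ∷ c ∷ rest →
    ((a < b × b < c) ⊎ (a > b × b > c)) →
    31 ≤ length π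
theorem4 π perm crucial a b c rest refl (inj₁ (a<b , b<c)) =
  three-gaps⇒long a b c rest crucial (dec-true (a <? b) a<b) (dec-true (b <? c) b<c)
    -- The insertion values are `suc a`, `suc b`, `suc c`, each just above its entry, so the
    -- extension starts with a descent.
    (above (here refl) ≤-refl) (above (there (here refl)) (<⇒≤ a<b))
    (above (there (there (here refl))) (<⇒≤ (<-trans a<b b<c)))
    (head-gap-≢ a b c rest (suc zero) a<b ≤-refl)
    (head-gap-≢ a b c rest (suc zero) a<b (m<n⇒m<1+n b<c))
    (head-gap-≢ a b c rest (suc (suc zero)) b<c ≤-refl)
  where
  above : ∀ {v} → v ∈ π → a ≤ v → 1 ≤ suc v × suc v ≤ suc (length π) × (suc v <ᵇ shift (suc v) a) ≡ false
  above v∈π a≤v = s≤s z≤n , s≤s (proj₂ (perm-bounds perm v∈π)) , <ᵇ-shift-< (s≤s a≤v)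
theorem4 π perm crucial a b c rest refl (inj₂ (b<a , c<b)) =
  three-gaps⇒long a b c rest crucial (dec-false (a <? b) (<⇒≯ b<a)) (dec-false (b <? c) (<⇒≯ c<b))
    -- The values are `c`, `b`, `a`: inserting `v` itself raises the old `v`, so the new entry sits
    -- just below it.
    (below (there (there (here refl))) (<⇒≤ (<-trans c<b b<a)))
    (below (there (here refl)) (<⇒≤ b<a)) (below (here refl) ≤-refl)
    (head-gap-≢ a b c rest (suc (suc zero)) ≤-refl c<b)
    (head-gap-≢ a b c rest (suc (suc zero)) ≤-refl (<-trans c<b b<a))
    (head-gap-≢ a b c rest (suc zero) ≤-refl b<a)
  where
  below : ∀ {v} → v ∈ π → v ≤ a → 1 ≤ v × v ≤ suc (length π) × (v <ᵇ shift v a) ≡ true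
  below v∈π v≤a with perm-bounds perm v∈π
  ... | 1≤v , v≤n = 1≤v , m≤n⇒m≤1+n v≤n , <ᵇ-shift-≥ v≤a
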